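{- $\operatorname{BSR}(5,4)\ge 12$.
   Context: An $m\times n$ biquadratic form is a polynomial $P(\mathbf{x},\mathbf{y})=\sum_{i=1}^m\sum_{j=1}^n\sum_{k=1}^m\sum_{l=1}^n a_{ijkl}\,x_i x_k y_j y_l$ with real coefficients, where $\mathbf{x}=(x_1,\dots,x_m)$ and $\mathbf{y}=(y_1,\dots,y_n)$. A bilinear form is a polynomial $\ell(\mathbf{x},\mathbf{y})=\sum_{i=1}^m\sum_{j=1}^n a_{ij}x_i y_j$ with real coefficients. For a biquadratic form $P$ that is a sum of squares of bilinear forms, the SOS rank $\operatorname{sos}(P)$ is the minimal number $r$ such that $P=\sum_{k=1}^r \ell_k(\mathbf{x},\mathbf{y})^2$ for some bilinear forms $\ell_1,\dots,\ell_r$. For positive integers $m,n$, $\operatorname{BSR}(m,n)$ denotes the maximum of $\operatorname{sos}(P)$ over all $m\times n$ biquadratic forms $P$ that are sums of squares of bilinear forms. -}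

module Defs where

open import Algebra.Bundles using (CommutativeRing)
open import Data.Fin using (Fin)
open import Data.Nat as ℕ using (ℕ; _⊔_)
import Data.Nat.Properties as ℕ
open import Data.Product using (∃; ∃-syntax; _×_; _,_)
open import Data.Rational using (ℚ; 0ℚ; 1ℚ; _+_; _*_; _-_; -_; ∣_∣; _<_; _≤_; 1/_; positive)
open import Data.Rational.Properties
open import Data.Rational.Solver using (module +-*-Solver)
open import Data.Vec.Functional using (Vector)
open import Level using (0ℓ)
open import Relation.Binary.PropositionalEquality using (_≡_; refl; sym; trans; cong; cong₂; subst)

-- The real numbers: Cauchy sequences of rationals, two of them being
-- identified when their difference is a null sequence.

Cauchy : (ℕ → ℚ) → Set
Cauchy s = ∀ ε → 0ℚ < ε → ∃[ N ] (∀ m n → N ℕ.≤ m → N ℕ.≤ n → ∣ s m - s n ∣ < ε)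

record ℝ : Set where
  constructor real
  field
    seq    : ℕ → ℚ
    cauchy : Cauchy seq
open ℝ public

infix 4 _≈ᴿ_
_≈ᴿ_ : ℝ → ℝ → Set
x ≈ᴿ y = ∀ ε → 0ℚ < ε → ∃[ N ] (∀ n → N ℕ.≤ n → ∣ seq x n - seq y n ∣ < ε)

private
  open +-*-Solver

  dist-refl : ∀ a → ∣ a - a ∣ ≡ 0ℚ
  dist-refl a = cong ∣_∣ (+-inverseʳ a)

  dist-sym : ∀ a b → ∣ a - b ∣ ≡ ∣ b - a ∣
  dist-sym a b = trans (cong ∣_∣ (solve 2 (λ a b → a :+ :- b := :- (b :+ :- a)) refl a b))
                       (∣-p∣≡∣p∣ (b - a))

  dist-triangle : ∀ a b c → ∣ a - c ∣ ≤ ∣ a - b ∣ + ∣ b - c ∣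
  dist-triangle a b c =
    subst (λ t → ∣ t ∣ ≤ ∣ a - b ∣ + ∣ b - c ∣)
      (solve 3 (λ a b c → (a :+ :- b) :+ (b :+ :- c) := a :+ :- c) refl a b c)
      (∣p+q∣≤∣p∣+∣q∣ (a - b) (b - c))

  dist-+ : ∀ a b c d → ∣ (a + b) - (c + d) ∣ ≤ ∣ a - c ∣ + ∣ b - d ∣
  dist-+ a b c d =
    subst (λ t → ∣ t ∣ ≤ ∣ a - c ∣ + ∣ b - d ∣)
      (solve 4 (λ a b c d → (a :+ :- c) :+ (b :+ :- d) := (a :+ b) :+ :- (c :+ d)) refl a b c d)
      (∣p+q∣≤∣p∣+∣q∣ (a - c) (b - d))

  dist-* : ∀ a b c d → ∣ (a * b) - (c * d) ∣ ≤ ∣ a ∣ * ∣ b - d ∣ + ∣ d ∣ * ∣ a - c ∣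
  dist-* a b c d = begin
    ∣ (a * b) - (c * d) ∣               ≡⟨ cong ∣_∣ (solve 4 (λ a b c d →
                                             (a :* b) :+ :- (c :* d) :=
                                             a :* (b :+ :- d) :+ d :* (a :+ :- c)) refl a b c d) ⟩
    ∣ a * (b - d) + d * (a - c) ∣       ≤⟨ ∣p+q∣≤∣p∣+∣q∣ (a * (b - d)) (d * (a - c)) ⟩
    ∣ a * (b - d) ∣ + ∣ d * (a - c) ∣   ≡⟨ cong₂ _+_ (∣p*q∣≡∣p∣*∣q∣ a (b - d)) (∣p*q∣≡∣p∣*∣q∣ d (a - c)) ⟩
    ∣ a ∣ * ∣ b - d ∣ + ∣ d ∣ * ∣ a - c ∣ ∎
    where open ≤-Reasoning

  divide : ∀ C ε → 0ℚ < C → 0ℚ < ε → ∃[ δ ] (0ℚ < δ × C * δ ≡ ε)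
  divide C ε 0<C 0<ε = (1/ C) * ε , positive⁻¹ _ {{pos*pos⇒pos (1/ C) ε}} ,
    trans (sym (*-assoc C (1/ C) ε)) (trans (cong (_* ε) (*-inverseʳ C)) (*-identityˡ ε))
    where instance
      posC = positive 0<C
      nzC  = pos⇒nonZero C
      pos1/C = 1/pos⇒pos C
      posε = positive 0<ε

  halve : ∀ ε → 0ℚ < ε → ∃[ δ ] (0ℚ < δ × δ + δ ≡ ε)
  halve ε 0<ε with divide (1ℚ + 1ℚ) ε (positive⁻¹ (1ℚ + 1ℚ)) 0<ε
  ... | δ , 0<δ , eq = δ , 0<δ ,
    trans (solve 1 (λ d → d :+ d := (con 1ℚ :+ con 1ℚ) :* d) refl δ) eq

  bounded : ∀ x → ∃[ B ] (0ℚ < B × ∃[ N ] (∀ n → N ℕ.≤ n → ∣ seq x n ∣ ≤ B))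
  bounded x with cauchy x 1ℚ (positive⁻¹ 1ℚ)
  ... | N , close = ∣ s N ∣ + 1ℚ , +-mono-≤-< (0≤∣p∣ (s N)) (positive⁻¹ 1ℚ) , N , bound
    where
    s = seq x
    open ≤-Reasoning
    bound : ∀ n → N ℕ.≤ n → ∣ s n ∣ ≤ ∣ s N ∣ + 1ℚ
    bound n N≤n = begin
      ∣ s n ∣                  ≡⟨ cong ∣_∣ (solve 2 (λ a b → a := b :+ (a :+ :- b)) refl (s n) (s N)) ⟩
      ∣ s N + (s n - s N) ∣    ≤⟨ ∣p+q∣≤∣p∣+∣q∣ (s N) (s n - s N) ⟩
      ∣ s N ∣ + ∣ s n - s N ∣  ≤⟨ +-monoʳ-≤ ∣ s N ∣ (<⇒≤ (close n N N≤n ℕ.≤-refl)) ⟩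
      ∣ s N ∣ + 1ℚ             ∎

  scaled-< : ∀ {A e δ} a → 0ℚ < A → ∣ a ∣ ≤ A → ∣ e ∣ < δ → ∣ a ∣ * ∣ e ∣ < A * δ
  scaled-< {A} {e} {δ} a 0<A a≤A e<δ = begin-strict
    ∣ a ∣ * ∣ e ∣  ≤⟨ *-monoʳ-≤-nonNeg ∣ e ∣ {{∣-∣-nonNeg e}} a≤A ⟩
    A * ∣ e ∣      <⟨ *-monoʳ-<-pos A {{positive 0<A}} e<δ ⟩
    A * δ          ∎
    where open ≤-Reasoning

  close-* : ∀ {A D δ ε} a b c d → 0ℚ < A → 0ℚ < D → (A + D) * δ ≡ ε →
            ∣ a ∣ ≤ A → ∣ d ∣ ≤ D → ∣ a - c ∣ < δ → ∣ b - d ∣ < δ →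
            ∣ (a * b) - (c * d) ∣ < ε
  close-* {A} {D} {δ} {ε} a b c d 0<A 0<D eq a≤A d≤D ac bd = begin-strict
    ∣ (a * b) - (c * d) ∣                  ≤⟨ dist-* a b c d ⟩
    ∣ a ∣ * ∣ b - d ∣ + ∣ d ∣ * ∣ a - c ∣  <⟨ +-mono-< (scaled-< {e = b - d} a 0<A a≤A bd) (scaled-< {e = a - c} d 0<D d≤D ac) ⟩
    A * δ + D * δ                          ≡⟨ sym (*-distribʳ-+ δ A D) ⟩
    (A + D) * δ                            ≡⟨ eq ⟩
    ε                                      ∎
    where open ≤-Reasoning

infixl 6 _+ᴿ_
infixl 7 _*ᴿ_
infix  8 -ᴿ_

fromℚ : ℚ → ℝ
fromℚ q = real (λ _ → q) λ ε 0<ε → 0 , λ _ _ _ _ → subst (_< ε) (sym (dist-refl q)) 0<ε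

0ᴿ 1ᴿ : ℝ
0ᴿ = fromℚ 0ℚ
1ᴿ = fromℚ 1ℚ

_+ᴿ_ : ℝ → ℝ → ℝ
x +ᴿ y = real (λ n → seq x n + seq y n) λ ε 0<ε →
  let δ , 0<δ , eq = halve ε 0<ε
      M , px = cauchy x δ 0<δ
      N , py = cauchy y δ 0<δ
  in M ⊔ N , λ m n ≤m ≤n →
    ≤-<-trans (dist-+ (seq x m) (seq y m) (seq x n) (seq y n))
      (subst (_ <_) eq (+-mono-<
        (px m n (ℕ.m⊔n≤o⇒m≤o M N ≤m) (ℕ.m⊔n≤o⇒m≤o M N ≤n))
        (py m n (ℕ.m⊔n≤o⇒n≤o M N ≤m) (ℕ.m⊔n≤o⇒n≤o M N ≤n))))

private
  dist-neg : ∀ a b → ∣ (- a) - (- b) ∣ ≡ ∣ a - b ∣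
  dist-neg a b = trans (cong ∣_∣ (solve 2 (λ a b → :- a :+ :- (:- b) := :- (a :+ :- b)) refl a b))
                       (∣-p∣≡∣p∣ (a - b))

-ᴿ_ : ℝ → ℝ
-ᴿ x = real (λ n → - seq x n) λ ε 0<ε →
  let N , p = cauchy x ε 0<ε
  in N , λ m n ≤m ≤n → subst (_< ε) (sym (dist-neg (seq x m) (seq x n))) (p m n ≤m ≤n)

_*ᴿ_ : ℝ → ℝ → ℝ
x *ᴿ y = real (λ n → seq x n * seq y n) λ ε 0<ε →
  let A , 0<A , M₁ , bx = bounded x
      D , 0<D , N₁ , by = bounded y
      δ , 0<δ , eq = divide (A + D) ε (+-mono-< 0<A 0<D) 0<ε
      M₂ , px = cauchy x δ 0<δ
      N₂ , py = cauchy y δ 0<δ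
      M = M₁ ⊔ M₂
      N = N₁ ⊔ N₂
  in M ⊔ N , λ m n ≤m ≤n →
    let M≤m = ℕ.m⊔n≤o⇒m≤o M N ≤m
        M≤n = ℕ.m⊔n≤o⇒m≤o M N ≤n
        N≤m = ℕ.m⊔n≤o⇒n≤o M N ≤m
        N≤n = ℕ.m⊔n≤o⇒n≤o M N ≤n
    in close-* (seq x m) (seq y m) (seq x n) (seq y n) 0<A 0<D eq
         (bx m (ℕ.m⊔n≤o⇒m≤o M₁ M₂ M≤m)) (by n (ℕ.m⊔n≤o⇒m≤o N₁ N₂ N≤n))
         (px m n (ℕ.m⊔n≤o⇒n≤o M₁ M₂ M≤m) (ℕ.m⊔n≤o⇒n≤o M₁ M₂ M≤n))
         (py m n (ℕ.m⊔n≤o⇒n≤o N₁ N₂ N≤m) (ℕ.m⊔n≤o⇒n≤o N₁ N₂ N≤n))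

private
  ≗⇒≈ : ∀ x y → (∀ n → seq x n ≡ seq y n) → x ≈ᴿ y
  ≗⇒≈ x y eq ε 0<ε = 0 , λ n _ →
    subst (_< ε) (sym (trans (cong (λ t → ∣ t - seq y n ∣) (eq n)) (dist-refl (seq y n)))) 0<ε

  ≈-refl : ∀ {x} → x ≈ᴿ x
  ≈-refl {x} = ≗⇒≈ x x λ _ → refl

  ≈-sym : ∀ {x y} → x ≈ᴿ y → y ≈ᴿ x
  ≈-sym {x} {y} x≈y ε 0<ε =
    let N , p = x≈y ε 0<ε
    in N , λ n ≤n → subst (_< ε) (dist-sym (seq x n) (seq y n)) (p n ≤n)

  ≈-trans : ∀ {x y z} → x ≈ᴿ y → y ≈ᴿ z → x ≈ᴿ z
  ≈-trans {x} {y} {z} x≈y y≈z ε 0<ε =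
    let δ , 0<δ , eq = halve ε 0<ε
        M , p = x≈y δ 0<δ
        N , q = y≈z δ 0<δ
    in M ⊔ N , λ n ≤n →
      ≤-<-trans (dist-triangle (seq x n) (seq y n) (seq z n))
        (subst (_ <_) eq (+-mono-< (p n (ℕ.m⊔n≤o⇒m≤o M N ≤n)) (q n (ℕ.m⊔n≤o⇒n≤o M N ≤n))))

  +-congᴿ : ∀ {x x′ y y′} → x ≈ᴿ x′ → y ≈ᴿ y′ → x +ᴿ y ≈ᴿ x′ +ᴿ y′
  +-congᴿ {x} {x′} {y} {y′} x≈ y≈ ε 0<ε =
    let δ , 0<δ , eq = halve ε 0<ε
        M , p = x≈ δ 0<δ
        N , q = y≈ δ 0<δ
    in M ⊔ N , λ n ≤n →
      ≤-<-trans (dist-+ (seq x n) (seq y n) (seq x′ n) (seq y′ n))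
        (subst (_ <_) eq (+-mono-< (p n (ℕ.m⊔n≤o⇒m≤o M N ≤n)) (q n (ℕ.m⊔n≤o⇒n≤o M N ≤n))))

  -‿congᴿ : ∀ {x y} → x ≈ᴿ y → -ᴿ x ≈ᴿ -ᴿ y
  -‿congᴿ {x} {y} x≈y ε 0<ε =
    let N , p = x≈y ε 0<ε
    in N , λ n ≤n → subst (_< ε) (sym (dist-neg (seq x n) (seq y n))) (p n ≤n)

  *-congᴿ : ∀ {x x′ y y′} → x ≈ᴿ x′ → y ≈ᴿ y′ → x *ᴿ y ≈ᴿ x′ *ᴿ y′
  *-congᴿ {x} {x′} {y} {y′} x≈ y≈ ε 0<ε =
    let A , 0<A , M₁ , bx = bounded x
        D , 0<D , N₁ , by = bounded y′
        δ , 0<δ , eq = divide (A + D) ε (+-mono-< 0<A 0<D) 0<ε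
        M₂ , px = x≈ δ 0<δ
        N₂ , py = y≈ δ 0<δ
        M = M₁ ⊔ M₂
        N = N₁ ⊔ N₂
    in M ⊔ N , λ n ≤n →
      let M≤n = ℕ.m⊔n≤o⇒m≤o M N ≤n
          N≤n = ℕ.m⊔n≤o⇒n≤o M N ≤n
      in close-* (seq x n) (seq y n) (seq x′ n) (seq y′ n) 0<A 0<D eq
           (bx n (ℕ.m⊔n≤o⇒m≤o M₁ M₂ M≤n)) (by n (ℕ.m⊔n≤o⇒m≤o N₁ N₂ N≤n))
           (px n (ℕ.m⊔n≤o⇒n≤o M₁ M₂ M≤n))
           (py n (ℕ.m⊔n≤o⇒n≤o N₁ N₂ N≤n))

ℝ-commutativeRing : CommutativeRing 0ℓ 0ℓ
ℝ-commutativeRing = record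
  { Carrier = ℝ ; _≈_ = _≈ᴿ_ ; _+_ = _+ᴿ_ ; _*_ = _*ᴿ_ ; -_ = -ᴿ_ ; 0# = 0ᴿ ; 1# = 1ᴿ
  ; isCommutativeRing = record
    { isRing = record
      { +-isAbelianGroup = record
        { isGroup = record
          { isMonoid = record
            { isSemigroup = record
              { isMagma = record
                { isEquivalence = record
                  { refl  = λ {x} → ≈-refl {x}
                  ; sym   = λ {x} {y} → ≈-sym {x} {y}
                  ; trans = λ {x} {y} {z} → ≈-trans {x} {y} {z}
                  }
                ; ∙-cong = λ {x} {x′} {y} {y′} → +-congᴿ {x} {x′} {y} {y′}
                }
              ; assoc = λ x y z → ≗⇒≈ ((x +ᴿ y) +ᴿ z) (x +ᴿ (y +ᴿ z)) λ n → +-assoc (seq x n) (seq y n) (seq z n)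
              }
            ; identity = (λ x → ≗⇒≈ (0ᴿ +ᴿ x) x λ n → +-identityˡ (seq x n))
                       , (λ x → ≗⇒≈ (x +ᴿ 0ᴿ) x λ n → +-identityʳ (seq x n))
            }
          ; inverse = (λ x → ≗⇒≈ (-ᴿ x +ᴿ x) 0ᴿ λ n → +-inverseˡ (seq x n))
                    , (λ x → ≗⇒≈ (x +ᴿ -ᴿ x) 0ᴿ λ n → +-inverseʳ (seq x n))
          ; ⁻¹-cong = λ {x} {y} → -‿congᴿ {x} {y}
          }
        ; comm = λ x y → ≗⇒≈ (x +ᴿ y) (y +ᴿ x) λ n → +-comm (seq x n) (seq y n)
        }
      ; *-cong = λ {x} {x′} {y} {y′} → *-congᴿ {x} {x′} {y} {y′}
      ; *-assoc = λ x y z → ≗⇒≈ ((x *ᴿ y) *ᴿ z) (x *ᴿ (y *ᴿ z)) λ n → *-assoc (seq x n) (seq y n) (seq z n)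
      ; *-identity = (λ x → ≗⇒≈ (1ᴿ *ᴿ x) x λ n → *-identityˡ (seq x n))
                   , (λ x → ≗⇒≈ (x *ᴿ 1ᴿ) x λ n → *-identityʳ (seq x n))
      ; distrib = (λ x y z → ≗⇒≈ (x *ᴿ (y +ᴿ z)) (x *ᴿ y +ᴿ x *ᴿ z) λ n → *-distribˡ-+ (seq x n) (seq y n) (seq z n))
                , (λ x y z → ≗⇒≈ ((y +ᴿ z) *ᴿ x) (y *ᴿ x +ᴿ z *ᴿ x) λ n → *-distribʳ-+ (seq x n) (seq y n) (seq z n))
      }
    ; *-comm = λ x y → ≗⇒≈ (x *ᴿ y) (y *ᴿ x) λ n → *-comm (seq x n) (seq y n)
    }
  }

open import Algebra.Properties.Semiring.Sum (CommutativeRing.semiring ℝ-commutativeRing) public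
  using (sum; sum-syntax)

-- Forms are given by their coefficients; the families a i j k l of a
-- biquadratic form are not unique, so forms are only ever compared
-- through the polynomial they define.

BiquadraticForm : ℕ → ℕ → Set
BiquadraticForm m n = Fin m → Fin n → Fin m → Fin n → ℝ

BilinearForm : ℕ → ℕ → Set
BilinearForm m n = Fin m → Fin n → ℝ

module _ {m n : ℕ} where

  evalBiquadratic : BiquadraticForm m n → Vector ℝ m → Vector ℝ n → ℝ
  evalBiquadratic a x y =
    ∑[ i < m ] ∑[ j < n ] ∑[ k < m ] ∑[ l < n ] (a i j k l *ᴿ x i *ᴿ x k *ᴿ y j *ᴿ y l)

  evalBilinear : BilinearForm m n → Vector ℝ m → Vector ℝ n → ℝ
  evalBilinear a x y = ∑[ i < m ] ∑[ j < n ] (a i j *ᴿ x i *ᴿ y j)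

  -- Equality of polynomials is equality of polynomial functions, ℝ being infinite.
  IsSumOfSquares : BiquadraticForm m n → ℕ → Set
  IsSumOfSquares P r = ∃ λ (ℓ : Fin r → BilinearForm m n) → ∀ x y →
    evalBiquadratic P x y ≈ᴿ (∑[ k < r ] (evalBilinear (ℓ k) x y *ᴿ evalBilinear (ℓ k) x y))

IsMinimum : (ℕ → Set) → ℕ → Set
IsMinimum S r = S r × (∀ s → S s → r ℕ.≤ s)

IsMaximum : (ℕ → Set) → ℕ → Set
IsMaximum S r = S r × (∀ s → S s → s ℕ.≤ r)

-- sos(P) = r; in particular P is a sum of squares.
IsSosRank : ∀ {m n} → BiquadraticForm m n → ℕ → Set
IsSosRank P = IsMinimum (IsSumOfSquares P)

SosRankAttained : ℕ → ℕ → ℕ → Set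
SosRankAttained m n r = ∃[ P ] IsSosRank {m} {n} P r

-- BSR(m,n) = r.  A minimum or maximum of a set of naturals cannot be computed
-- constructively, so sos and BSR are relations rather than functions.
IsBSR : ℕ → ℕ → ℕ → Set
IsBSR m n = IsMaximum (SosRankAttained m n)

-- The witness is P = ∑ uₜ², where the uₜ are the nine monomials x_i y_j over the cells
-- (i,j) = 12, 22, 31, 33, 34, 42, 43, 52, 54 and the three differences x₁y₃ − x₁y₁,
-- x₂y₁ − x₁y₁, x₂y₄ − x₁y₁ (numbered from 1; Fin counts from 0).  P vanishes at the seven
-- unit points (e_i, e_j) with ij = 14, 23, 32, 41, 44, 51, 53 and at the point
-- (e₁ + e₂, e₁ + e₃ + e₄).  If also P = ∑ ℓₖ², every ℓₖ vanishes at these eight points.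
-- Let H be the difference of the two Gram forms ∑ ℓₖ ⊗ ℓₖ and ∑ uₜ ⊗ uₜ.  By polarization
-- H(x,y,x′,y′) = − H(x,y′,x′,y), so H is determined by its values on the rectangles of the
-- 5 × 4 grid; only five rectangles avoid the seven cells, and the eighth zero kills those.
-- Hence H = 0, which says that the coefficients of the ℓₖ at the twelve cells leading the uₜ
-- form a matrix with orthonormal columns, and such a matrix has at least twelve rows.

module Submission where

open import Defs hiding (sum; sum-syntax)
open import Algebra.Bundles using (CommutativeRing)
import Algebra.Properties.AbelianGroup as AbelianGroupProperties
import Algebra.Properties.Monoid.Mult as MonoidMult
import Algebra.Properties.Semiring.Sum as SemiringSum
import Algebra.Solver.Ring.NaturalCoefficients.Default as SemiringSolver
open import Data.Bool using (if_then_else_; _∧_)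
open import Data.Fin using (Fin; zero; suc; punchIn; _≟_)
open import Data.Fin.Patterns using (0F; 1F; 2F; 3F; 4F)
open import Data.Fin.Properties using (all?; any?; punchInᵢ≢i)
open import Data.List using (List; []; _∷_)
import Data.List.Membership.DecPropositional as DecMembership
open import Data.List.Membership.Propositional using (_∈_)
open import Data.Nat as ℕ using (ℕ; zero; suc; _≤_)
import Data.Nat.Properties as ℕ
open import Data.Product using (∃-syntax; _×_; _,_; proj₁; proj₂)
open import Data.Product.Properties using (≡-dec)
open import Data.Rational as ℚ using (ℚ; 0ℚ; 1ℚ; ½)
import Data.Rational.Properties as ℚ
import Data.Rational.Solver as ℚ-Solver
open import Data.Sum using (_⊎_; inj₁; inj₂)
open import Data.Vec using (lookup; []; _∷_)
open import Data.Vec.Functional using (Vector; removeAt; foldr)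
open import Function using (_∘_)
open import Level using (0ℓ)
open import Relation.Binary.PropositionalEquality as ≡ using (_≡_)
import Relation.Binary.Reasoning.Setoid as SetoidReasoning
open import Relation.Nullary using (¬_; Dec; does; yes; no; contradiction)
open import Relation.Nullary.Decidable using (_⊎-dec_; _×-dec_; _→-dec_; from-yes)

-- Index tuples of the 5 × 4 grid: the finite combinatorial check.

Cell : Set
Cell = Fin 5 × Fin 4

_≟ᶜ_ : (c d : Cell) → Dec (c ≡ d)
_≟ᶜ_ = ≡-dec _≟_ _≟_

open DecMembership _≟ᶜ_ using (_∈?_)

Relation : Set₁
Relation = Fin 5 → Fin 4 → Fin 5 → Fin 4 → Set

-- H i j k l vanishes together with its values at these four index tuples.
Orbit : Relation → Relation
Orbit P i j k l = P i j k l ⊎ P k l i j ⊎ P i l k j ⊎ P k j i l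

orbit? : ∀ {P : Relation} → (∀ i j k l → Dec (P i j k l)) → ∀ i j k l → Dec (Orbit P i j k l)
orbit? P? i j k l = P? i j k l ⊎-dec P? k l i j ⊎-dec P? i l k j ⊎-dec P? k j i l

zeroCells : List Cell
zeroCells = (0F , 3F) ∷ (1F , 2F) ∷ (2F , 1F) ∷ (3F , 0F) ∷ (3F , 3F)
          ∷ (4F , 0F) ∷ (4F , 2F) ∷ []

-- The support of (e₁ + e₂) ⊗ (e₁ + e₃ + e₄).
block : Fin 6 → Cell
block = lookup ((0F , 0F) ∷ (0F , 2F) ∷ (0F , 3F) ∷ (1F , 0F) ∷ (1F , 2F) ∷ (1F , 3F) ∷ [])

rowOf : Fin 6 → Fin 5
rowOf = proj₁ ∘ block

colOf : Fin 6 → Fin 4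
colOf = proj₂ ∘ block

-- The row and column cases come from polarization, the third from the zeros at unit points.
Obvious : Relation
Obvious i j k l = i ≡ k ⊎ j ≡ l ⊎ (i , j) ∈ zeroCells

-- The relation ∑ₛ H (block s) (k,l) = 0 has no other possibly nonzero term than H (i,j) (k,l).
Isolated : Relation
Isolated i j k l = ∃[ t ] (block t ≡ (i , j) ×
  (∀ s → s ≡ t ⊎ Orbit Obvious (rowOf s) (colOf s) k l))

obvious? : ∀ i j k l → Dec (Obvious i j k l)
obvious? i j k l = i ≟ k ⊎-dec j ≟ l ⊎-dec (i , j) ∈? zeroCells

isolated? : ∀ i j k l → Dec (Isolated i j k l)
isolated? i j k l = any? λ t → block t ≟ᶜ (i , j) ×-dec
  all? λ s → s ≟ t ⊎-dec orbit? obvious? (rowOf s) (colOf s) k l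

-- Decided by running through all 400 tuples. The outer orbit is there because `Isolated` looks only
-- at the corner in first position, which must lie in the block; it serves the five rectangles that
-- avoid the zero cells.
exhausted : ∀ i j k l → Orbit (λ i j k l → Orbit Obvious i j k l ⊎ Isolated i j k l) i j k l
exhausted = from-yes (all? λ i → all? λ j → all? λ k → all? λ l →
  orbit? (λ i j k l → orbit? obvious? i j k l ⊎-dec isolated? i j k l) i j k l)

-- Finite sums and unit vectors over a commutative ring.

module BilinearForms (R : CommutativeRing 0ℓ 0ℓ) where

  open CommutativeRing R hiding (zero)
  open SemiringSum semiring
  open MonoidMult +-monoid using () renaming (_×_ to _·_; ×-homo-+ to ·-homo-+)
  open SemiringSolver commutativeSemiring using (solve; _:=_; _:+_; _:*_; con)
  open AbelianGroupProperties +-abelianGroup using (⁻¹-∙-comm; identityʳ-unique; x∙y⁻¹≈ε⇒x≈y)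
  open SetoidReasoning setoid

  Form : ℕ → ℕ → Set
  Form m n = Fin m → Fin n → Carrier

  Family : ℕ → ℕ → ℕ → Set
  Family r m n = Fin r → Form m n

  -- Used both as the Kronecker delta and, partially applied, as the unit vectors: `δ i` is e_i.
  δ : ∀ {n} → Fin n → Fin n → Carrier
  δ zero    zero    = 1#
  δ zero    (suc _) = 0#
  δ (suc _) zero    = 0#
  δ (suc i) (suc j) = δ i j

  sum-zero : ∀ {n} {f : Vector Carrier n} → (∀ i → f i ≈ 0#) → sum f ≈ 0#
  sum-zero {n} f≈0 = trans (sum-cong-≋ f≈0) (sum-replicate-zero n)

  sum-isolate : ∀ {n} (f : Vector Carrier n) i → (∀ j → j ≡ i ⊎ f j ≈ 0#) → sum f ≈ f i
  sum-isolate {suc n} f i others = begin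
    sum f                      ≈⟨ sum-remove {i = i} f ⟩
    f i + sum (removeAt f i)   ≈⟨ +-congˡ (sum-zero rest) ⟩
    f i + 0#                   ≈⟨ +-identityʳ _ ⟩
    f i                        ∎
    where
    rest : ∀ j → f (punchIn i j) ≈ 0#
    rest j with others (punchIn i j)
    ... | inj₁ eq  = contradiction eq (punchInᵢ≢i i j)
    ... | inj₂ f≈0 = f≈0

  δ-refl : ∀ {n} (i : Fin n) → δ i i ≡ 1#
  δ-refl zero    = ≡.refl
  δ-refl (suc i) = δ-refl i

  δ-off : ∀ {n} (i j : Fin n) → j ≡ i ⊎ δ i j ≡ 0#
  δ-off zero    zero    = inj₁ ≡.refl
  δ-off zero    (suc j) = inj₂ ≡.refl
  δ-off (suc i) zero    = inj₂ ≡.refl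
  δ-off (suc i) (suc j) with δ-off i j
  ... | inj₁ eq = inj₁ (≡.cong suc eq)
  ... | inj₂ eq = inj₂ eq

  δ-sym : ∀ {n} (i j : Fin n) → δ i j ≡ δ j i
  δ-sym zero    zero    = ≡.refl
  δ-sym zero    (suc j) = ≡.refl
  δ-sym (suc i) zero    = ≡.refl
  δ-sym (suc i) (suc j) = δ-sym i j

  sum-δ : ∀ {n} (f : Vector Carrier n) i → ∑[ j < n ] (f j * δ i j) ≈ f i
  sum-δ f i = trans
    (sum-isolate (λ j → f j * δ i j) i λ j → off j (δ-off i j))
    (trans (*-congˡ (reflexive (δ-refl i))) (*-identityʳ (f i)))
    where
    off : ∀ j → j ≡ i ⊎ δ i j ≡ 0# → j ≡ i ⊎ f j * δ i j ≈ 0#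
    off j (inj₁ eq) = inj₁ eq
    off j (inj₂ eq) = inj₂ (trans (*-congˡ (reflexive eq)) (zeroʳ (f j)))

  infixl 6 _⊕_
  _⊕_ : ∀ {n} → Vector Carrier n → Vector Carrier n → Vector Carrier n
  (x ⊕ y) i = x i + y i

  -- Bilinear forms and their Gram forms.

  module _ {m n : ℕ} where

    eval : Form m n → Vector Carrier m → Vector Carrier n → Carrier
    eval a x y = ∑[ i < m ] ∑[ j < n ] (a i j * x i * y j)

    eval-⊕ˡ : ∀ a x x′ y → eval a (x ⊕ x′) y ≈ eval a x y + eval a x′ y
    eval-⊕ˡ a x x′ y = trans
      (sum-cong-≋ λ i → trans
        (sum-cong-≋ λ j → solve 4 (λ a x x′ y → a :* (x :+ x′) :* y := a :* x :* y :+ a :* x′ :* y)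
                            refl (a i j) (x i) (x′ i) (y j))
        (∑-distrib-+ (λ j → a i j * x i * y j) (λ j → a i j * x′ i * y j)))
      (∑-distrib-+ (λ i → ∑[ j < n ] (a i j * x i * y j)) (λ i → ∑[ j < n ] (a i j * x′ i * y j)))

    eval-⊕ʳ : ∀ a x y y′ → eval a x (y ⊕ y′) ≈ eval a x y + eval a x y′
    eval-⊕ʳ a x y y′ = trans
      (sum-cong-≋ λ i → trans
        (sum-cong-≋ λ j → distribˡ (a i j * x i) (y j) (y′ j))
        (∑-distrib-+ (λ j → a i j * x i * y j) (λ j → a i j * x i * y′ j)))
      (∑-distrib-+ (λ i → ∑[ j < n ] (a i j * x i * y j)) (λ i → ∑[ j < n ] (a i j * x i * y′ j)))

    eval-δ : ∀ a i j → eval a (δ i) (δ j) ≈ a i j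
    eval-δ a i j = begin
      ∑[ k < m ] ∑[ l < n ] (a k l * δ i k * δ j l)  ≈⟨ sum-cong-≋ (λ k → sum-δ (λ l → a k l * δ i k) j) ⟩
      ∑[ k < m ] (a k j * δ i k)                     ≈⟨ sum-δ (λ k → a k j) i ⟩
      a i j                                          ∎

    -- The form ∑ ℓₖ ⊗ ℓₖ; on the diagonal x′ = x, y′ = y it is the sum of squares ∑ ℓₖ².
    gram : ∀ {r} → Family r m n → (x : Vector Carrier m) (y : Vector Carrier n)
           (x′ : Vector Carrier m) (y′ : Vector Carrier n) → Carrier
    gram {r} ℓ x y x′ y′ = ∑[ k < r ] (eval (ℓ k) x y * eval (ℓ k) x′ y′)

    gram-sym : ∀ {r} (ℓ : Family r m n) x y x′ y′ → gram ℓ x y x′ y′ ≈ gram ℓ x′ y′ x y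
    gram-sym ℓ x y x′ y′ = sum-cong-≋ λ k → *-comm (eval (ℓ k) x y) (eval (ℓ k) x′ y′)

    gram-⊕ˡ : ∀ {r} (ℓ : Family r m n) x x₂ y x′ y′ →
              gram ℓ (x ⊕ x₂) y x′ y′ ≈ gram ℓ x y x′ y′ + gram ℓ x₂ y x′ y′
    gram-⊕ˡ ℓ x x₂ y x′ y′ = trans
      (sum-cong-≋ λ k → trans (*-congʳ (eval-⊕ˡ (ℓ k) x x₂ y))
        (distribʳ (eval (ℓ k) x′ y′) (eval (ℓ k) x y) (eval (ℓ k) x₂ y)))
      (∑-distrib-+ (λ k → eval (ℓ k) x y * eval (ℓ k) x′ y′) (λ k → eval (ℓ k) x₂ y * eval (ℓ k) x′ y′))

    gram-⊕ʳ : ∀ {r} (ℓ : Family r m n) x y y₂ x′ y′ →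
              gram ℓ x (y ⊕ y₂) x′ y′ ≈ gram ℓ x y x′ y′ + gram ℓ x y₂ x′ y′
    gram-⊕ʳ ℓ x y y₂ x′ y′ = trans
      (sum-cong-≋ λ k → trans (*-congʳ (eval-⊕ʳ (ℓ k) x y y₂))
        (distribʳ (eval (ℓ k) x′ y′) (eval (ℓ k) x y) (eval (ℓ k) x y₂)))
      (∑-distrib-+ (λ k → eval (ℓ k) x y * eval (ℓ k) x′ y′) (λ k → eval (ℓ k) x y₂ * eval (ℓ k) x′ y′))

    gram-zero : ∀ {r} (ℓ : Family r m n) x y → (∀ k → eval (ℓ k) x y ≈ 0#) →
                ∀ x′ y′ → gram ℓ x y x′ y′ ≈ 0#
    gram-zero ℓ x y vanish x′ y′ = sum-zero λ k → trans (*-congʳ (vanish k)) (zeroˡ (eval (ℓ k) x′ y′))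

    gram-δ : ∀ {r} (ℓ : Family r m n) i j k l →
             gram ℓ (δ i) (δ j) (δ k) (δ l) ≈ ∑[ s < r ] (ℓ s i j * ℓ s k l)
    gram-δ ℓ i j k l = sum-cong-≋ λ s → *-cong (eval-δ (ℓ s) i j) (eval-δ (ℓ s) k l)

    quartic : (Fin m → Fin n → Fin m → Fin n → Carrier) → Vector Carrier m → Vector Carrier n → Carrier
    quartic a x y = ∑[ i < m ] ∑[ j < n ] ∑[ k < m ] ∑[ l < n ] (a i j k l * x i * x k * y j * y l)

    squares : ∀ {r} → Family r m n → Fin m → Fin n → Fin m → Fin n → Carrier
    squares {r} ℓ i j k l = ∑[ t < r ] (ℓ t i j * ℓ t k l)

    -- Each term splits into two factors `w`, one per cell. The sum over `t` is then moved
    -- outermost, where the remaining fourfold sum factors as a square.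
    quartic-squares : ∀ {r} (ℓ : Family r m n) x y → quartic (squares ℓ) x y ≈ gram ℓ x y x y
    quartic-squares {r} ℓ x y = begin
      ∑[ i < m ] ∑[ j < n ] ∑[ k < m ] ∑[ l < n ] (squares ℓ i j k l * x i * x k * y j * y l)
        ≈⟨ sum-cong-≋ (λ i → sum-cong-≋ λ j → sum-cong-≋ λ k → sum-cong-≋ λ l → coefficient i j k l) ⟩
      ∑[ i < m ] ∑[ j < n ] ∑[ k < m ] ∑[ l < n ] ∑[ t < r ] (w t i j * w t k l)
        ≈⟨ sum-cong-≋ (λ i → sum-cong-≋ λ j → trans
             (sum-cong-≋ λ k → ∑-comm (λ l t → w t i j * w t k l))
             (∑-comm (λ k t → ∑[ l < n ] (w t i j * w t k l)))) ⟩
      ∑[ i < m ] ∑[ j < n ] ∑[ t < r ] ∑[ k < m ] ∑[ l < n ] (w t i j * w t k l)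
        ≈⟨ trans
             (sum-cong-≋ λ i → ∑-comm (λ j t → ∑[ k < m ] ∑[ l < n ] (w t i j * w t k l)))
             (∑-comm (λ i t → ∑[ j < n ] ∑[ k < m ] ∑[ l < n ] (w t i j * w t k l))) ⟩
      ∑[ t < r ] ∑[ i < m ] ∑[ j < n ] ∑[ k < m ] ∑[ l < n ] (w t i j * w t k l)
        ≈⟨ sum-cong-≋ (λ t → sym (product t)) ⟩
      ∑[ t < r ] (eval (ℓ t) x y * eval (ℓ t) x y) ∎
      where
      w : Family r m n
      w t i j = ℓ t i j * x i * y j

      coefficient : ∀ i j k l → squares ℓ i j k l * x i * x k * y j * y l ≈
                                ∑[ t < r ] (w t i j * w t k l)
      coefficient i j k l = begin
        squares ℓ i j k l * x i * x k * y j * y l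
          ≈⟨ solve 5 (λ q a b c d → q :* a :* b :* c :* d := q :* (a :* b :* c :* d))
               refl (squares ℓ i j k l) (x i) (x k) (y j) (y l) ⟩
        squares ℓ i j k l * (x i * x k * y j * y l)
          ≈⟨ *-distribʳ-sum (x i * x k * y j * y l) (λ t → ℓ t i j * ℓ t k l) ⟩
        ∑[ t < r ] (ℓ t i j * ℓ t k l * (x i * x k * y j * y l))
          ≈⟨ sum-cong-≋ (λ t → solve 6
               (λ p q a b c d → p :* q :* (a :* b :* c :* d) := p :* a :* c :* (q :* b :* d))
               refl (ℓ t i j) (ℓ t k l) (x i) (x k) (y j) (y l)) ⟩
        ∑[ t < r ] (w t i j * w t k l) ∎

      product : ∀ t → eval (ℓ t) x y * eval (ℓ t) x y ≈
                ∑[ i < m ] ∑[ j < n ] ∑[ k < m ] ∑[ l < n ] (w t i j * w t k l)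
      product t = trans (*-distribʳ-sum (eval (ℓ t) x y) (λ i → ∑[ j < n ] w t i j)) (sum-cong-≋ λ i →
        trans (*-distribʳ-sum (eval (ℓ t) x y) (w t i)) (sum-cong-≋ λ j →
        trans (*-distribˡ-sum (w t i j) (λ k → ∑[ l < n ] w t k l)) (sum-cong-≋ λ k →
        *-distribˡ-sum (w t i j) (w t k))))

  -- Matrices with orthonormal columns.

  -- For a matrix C with orthonormal columns, D = C Cᵀ is a projection of trace n,
  -- so r - n = ‖I - D‖².
  module Orthonormal {r n : ℕ} (C : Fin r → Fin n → Carrier)
    (orthonormal : ∀ s t → ∑[ k < r ] (C k s * C k t) ≈ δ s t) where

    D : Fin r → Fin r → Carrier
    D k k′ = ∑[ t < n ] (C k t * C k′ t)

    trace-D : ∑[ k < r ] D k k ≈ n · 1#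
    trace-D = begin
      ∑[ k < r ] ∑[ t < n ] (C k t * C k t)  ≈⟨ ∑-comm (λ k t → C k t * C k t) ⟩
      ∑[ t < n ] ∑[ k < r ] (C k t * C k t)  ≈⟨ sum-cong-≋ (λ t → trans (orthonormal t t) (reflexive (δ-refl t))) ⟩
      ∑[ t < n ] 1#                          ≈⟨ sum-replicate n ⟩
      n · 1#                                 ∎

    -- This is D C = C, from C (Cᵀ C) = C.
    D-image : ∀ k s → ∑[ k′ < r ] (C k′ s * D k k′) ≈ C k s
    D-image k s = begin
      ∑[ k′ < r ] (C k′ s * ∑[ t < n ] (C k t * C k′ t))
        ≈⟨ sum-cong-≋ (λ k′ → trans (*-distribˡ-sum (C k′ s) (λ t → C k t * C k′ t)) (sum-cong-≋ λ t →
             solve 3 (λ a b c → a :* (b :* c) := b :* (a :* c)) refl (C k′ s) (C k t) (C k′ t))) ⟩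
      ∑[ k′ < r ] ∑[ t < n ] (C k t * (C k′ s * C k′ t))
        ≈⟨ ∑-comm (λ k′ t → C k t * (C k′ s * C k′ t)) ⟩
      ∑[ t < n ] ∑[ k′ < r ] (C k t * (C k′ s * C k′ t))
        ≈⟨ sum-cong-≋ (λ t → trans (sym (*-distribˡ-sum (C k t) (λ k′ → C k′ s * C k′ t))) (*-congˡ (orthonormal s t))) ⟩
      ∑[ t < n ] (C k t * δ s t)
        ≈⟨ sum-δ (C k) s ⟩
      C k s ∎

    -- The diagonal of D² = D, with D symmetric: (D C) Cᵀ = C Cᵀ.
    D-idempotent : ∀ k → ∑[ k′ < r ] (D k k′ * D k k′) ≈ D k k
    D-idempotent k = begin
      ∑[ k′ < r ] (D k k′ * D k k′)
        ≈⟨ sum-cong-≋ (λ k′ → trans (*-distribʳ-sum (D k k′) (λ s → C k s * C k′ s)) (sum-cong-≋ λ s →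
             *-assoc (C k s) (C k′ s) (D k k′))) ⟩
      ∑[ k′ < r ] ∑[ s < n ] (C k s * (C k′ s * D k k′))
        ≈⟨ ∑-comm (λ k′ s → C k s * (C k′ s * D k k′)) ⟩
      ∑[ s < n ] ∑[ k′ < r ] (C k s * (C k′ s * D k k′))
        ≈⟨ sum-cong-≋ (λ s → trans (sym (*-distribˡ-sum (C k s) (λ k′ → C k′ s * D k k′))) (*-congˡ (D-image k s))) ⟩
      D k k ∎

    gap : Fin r → Fin r → Carrier
    gap k k′ = δ k k′ - D k k′

    gap² : Fin r → Carrier
    gap² k = ∑[ k′ < r ] (gap k k′ * gap k k′)

    δ≈gap+D : ∀ k k′ → δ k k′ ≈ gap k k′ + D k k′
    δ≈gap+D k k′ = sym (trans (+-assoc _ _ _) (trans (+-congˡ (-‿inverseˡ _)) (+-identityʳ _)))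

    -- (δ - D)² + 2 D δ = δ² + D², written without subtraction.
    complete-square : ∀ {d e q} → d ≈ e + q → e * e + (q * d + q * d) ≈ d * d + q * q
    complete-square {d} {e} {q} d≈ = begin
      e * e + (q * d + q * d)              ≈⟨ +-congˡ (+-cong (*-congˡ d≈) (*-congˡ d≈)) ⟩
      e * e + (q * (e + q) + q * (e + q))  ≈⟨ solve 2 (λ e q → e :* e :+ (q :* (e :+ q) :+ q :* (e :+ q)) :=
                                                (e :+ q) :* (e :+ q) :+ q :* q) refl e q ⟩
      (e + q) * (e + q) + q * q            ≈⟨ +-congʳ (*-cong d≈ d≈) ⟨
      d * d + q * q                        ∎

    -- Row k of I - D has squared norm 1 - 2 D_kk + D_kk. To avoid subtraction, D_kk is added twice
    -- and one copy is cancelled at the end.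
    gap-row : ∀ k → gap² k + D k k ≈ 1#
    gap-row k = +-cancelʳ (D k k) (gap² k + D k k) 1# (begin
      (gap² k + D k k) + D k k
        ≈⟨ +-assoc _ _ _ ⟩
      gap² k + (D k k + D k k)
        ≈⟨ +-congˡ (trans (∑-distrib-+ (λ k′ → D k k′ * δ k k′) (λ k′ → D k k′ * δ k k′))
             (+-cong (sum-δ (D k) k) (sum-δ (D k) k))) ⟨
      gap² k + ∑[ k′ < r ] (D k k′ * δ k k′ + D k k′ * δ k k′)
        ≈⟨ ∑-distrib-+ (λ k′ → gap k k′ * gap k k′) (λ k′ → D k k′ * δ k k′ + D k k′ * δ k k′) ⟨
      ∑[ k′ < r ] (gap k k′ * gap k k′ + (D k k′ * δ k k′ + D k k′ * δ k k′))
        ≈⟨ sum-cong-≋ (λ k′ → complete-square (δ≈gap+D k k′)) ⟩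
      ∑[ k′ < r ] (δ k k′ * δ k k′ + D k k′ * D k k′)
        ≈⟨ ∑-distrib-+ (λ k′ → δ k k′ * δ k k′) (λ k′ → D k k′ * D k k′) ⟩
      ∑[ k′ < r ] (δ k k′ * δ k k′) + ∑[ k′ < r ] (D k k′ * D k k′)
        ≈⟨ +-cong (trans (sum-δ (δ k) k) (reflexive (δ-refl k))) (D-idempotent k) ⟩
      1# + D k k ∎)
      where open import Algebra.Properties.Group +-group using () renaming (∙-cancelʳ to +-cancelʳ)

    gap-norm : ∑[ k < r ] gap² k + n · 1# ≈ r · 1#
    gap-norm = begin
      ∑[ k < r ] gap² k + n · 1#              ≈⟨ +-congˡ trace-D ⟨
      ∑[ k < r ] gap² k + ∑[ k < r ] D k k    ≈⟨ ∑-distrib-+ gap² (λ k → D k k) ⟨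
      ∑[ k < r ] (gap² k + D k k)             ≈⟨ sum-cong-≋ gap-row ⟩
      ∑[ k < r ] 1#                           ≈⟨ sum-replicate r ⟩
      r · 1#                                  ∎

  -- Positivity and the rank bound for orthonormal columns.

  record IsPositiveCone (_≥0 : Carrier → Set) : Set where
    field
      0≥0       : 0# ≥0
      1≥0       : 1# ≥0
      +-≥0      : ∀ {x y} → x ≥0 → y ≥0 → (x + y) ≥0
      square-≥0 : ∀ x → (x * x) ≥0
      conical   : ∀ {x y} → x ≥0 → y ≥0 → x + y ≈ 0# → x ≈ 0#
      reduced   : ∀ x → x * x ≈ 0# → x ≈ 0#
      1≉0       : ¬ 1# ≈ 0#

    sum-≥0 : ∀ {n} (f : Vector Carrier n) → (∀ i → f i ≥0) → sum f ≥0
    sum-≥0 {zero}  f f≥0 = 0≥0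
    sum-≥0 {suc n} f f≥0 = +-≥0 (f≥0 zero) (sum-≥0 (f ∘ suc) (f≥0 ∘ suc))

    ·-≥0 : ∀ n → (n · 1#) ≥0
    ·-≥0 zero    = 0≥0
    ·-≥0 (suc n) = +-≥0 1≥0 (·-≥0 n)

    squares-zero : ∀ {n} (f : Vector Carrier n) → ∑[ i < n ] (f i * f i) ≈ 0# → ∀ i → f i ≈ 0#
    squares-zero {suc n} f sum≈0 = λ where
        zero    → reduced (f zero) (conical head≥0 tail≥0 sum≈0)
        (suc i) → squares-zero (f ∘ suc) (conical tail≥0 head≥0 (trans (+-comm _ _) sum≈0)) i
      where
      head≥0 = square-≥0 (f zero)
      tail≥0 = sum-≥0 (λ i → f (suc i) * f (suc i)) (λ i → square-≥0 (f (suc i)))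

    -- If n = r + 1 + d, then `gap-norm` gives S + (r + 1 + d) = r, hence 1 + (d + S) = 0 with both
    -- summands in the cone, and `conical` yields 1 = 0.
    orthonormal-≤ : ∀ {r n} (C : Fin r → Fin n → Carrier) →
                    (∀ s t → ∑[ k < r ] (C k s * C k t) ≈ δ s t) → n ≤ r
    orthonormal-≤ {r} {n} C orthonormal = ℕ.≮⇒≥ λ r<n → 1≉0 (1≈0 (ℕ.m≤n⇒∃[o]m+o≡n r<n))
      where
      open Orthonormal C orthonormal
      S = ∑[ k < r ] gap² k

      S≥0 : S ≥0
      S≥0 = sum-≥0 gap² λ k → sum-≥0 (λ k′ → gap k k′ * gap k k′) λ k′ → square-≥0 (gap k k′)

      1≈0 : ∃[ d ] suc r ℕ.+ d ≡ n → 1# ≈ 0#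
      1≈0 (d , ≡.refl) = conical 1≥0 (+-≥0 (·-≥0 d) S≥0)
        (identityʳ-unique (r · 1#) (1# + (d · 1# + S)) (begin
          r · 1# + (1# + (d · 1# + S))   ≈⟨ solve 4 (λ r o d s → r :+ (o :+ (d :+ s)) := s :+ (o :+ (r :+ d)))
                                              refl (r · 1#) 1# (d · 1#) S ⟩
          S + (1# + (r · 1# + d · 1#))   ≈⟨ +-congˡ (+-congˡ (·-homo-+ 1# r d)) ⟨
          S + (suc r ℕ.+ d) · 1#         ≈⟨ gap-norm ⟩
          r · 1#                         ∎))

  -- Polarization of the difference of two Gram forms.

  module Comparison {m n r s : ℕ} (halve : ∀ {x} → x + x ≈ 0# → x ≈ 0#)
    (ℓ : Family r m n) (u : Family s m n)
    (same : ∀ x y → gram ℓ x y x y ≈ gram u x y x y) where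

    -- The form H. Equality of the two polynomials says directly only that H vanishes for x′ = x, y′
    -- = y.
    defect : Vector Carrier m → Vector Carrier n → Vector Carrier m → Vector Carrier n → Carrier
    defect x y x′ y′ = gram ℓ x y x′ y′ - gram u x y x′ y′

    equal⇒zero : ∀ {a b} → a ≈ b → a - b ≈ 0#
    equal⇒zero {a} {b} a≈b = trans (+-congʳ a≈b) (-‿inverseʳ b)

    split : ∀ {p a b q c d} → p ≈ a + b → q ≈ c + d → p - q ≈ (a - c) + (b - d)
    split {p} {a} {b} {q} {c} {d} p≈ q≈ = begin
      p - q                   ≈⟨ +-cong p≈ (-‿cong q≈) ⟩
      (a + b) - (c + d)       ≈⟨ +-congˡ (⁻¹-∙-comm c d) ⟨
      (a + b) + (- c + - d)   ≈⟨ solve 4 (λ a b c d → (a :+ b) :+ (c :+ d) := (a :+ c) :+ (b :+ d))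
                                   refl a b (- c) (- d) ⟩
      (a - c) + (b - d)       ∎

    defect-sym : ∀ x y x′ y′ → defect x y x′ y′ ≈ defect x′ y′ x y
    defect-sym x y x′ y′ = +-cong (gram-sym ℓ x y x′ y′) (-‿cong (gram-sym u x y x′ y′))

    defect-⊕ˡ : ∀ x x₂ y x′ y′ → defect (x ⊕ x₂) y x′ y′ ≈ defect x y x′ y′ + defect x₂ y x′ y′
    defect-⊕ˡ x x₂ y x′ y′ = split (gram-⊕ˡ ℓ x x₂ y x′ y′) (gram-⊕ˡ u x x₂ y x′ y′)

    defect-⊕ʳ : ∀ x y y₂ x′ y′ → defect x (y ⊕ y₂) x′ y′ ≈ defect x y x′ y′ + defect x y₂ x′ y′
    defect-⊕ʳ x y y₂ x′ y′ = split (gram-⊕ʳ ℓ x y y₂ x′ y′) (gram-⊕ʳ u x y y₂ x′ y′)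

    defect-diagonal : ∀ x y → defect x y x y ≈ 0#
    defect-diagonal x y = equal⇒zero (same x y)

    -- In a polarized expansion the outer terms vanish and the two mixed ones remain.
    outer-zero : ∀ {a b c d} → a ≈ 0# → d ≈ 0# → (a + b) + (c + d) ≈ b + c
    outer-zero {a} {b} {c} {d} a≈0 d≈0 = +-cong
      (trans (+-congʳ a≈0) (+-identityˡ b)) (trans (+-congˡ d≈0) (+-identityʳ c))

    -- Polarization in x: expanding H at the point (x + x′, y) leaves two mixed terms, equal by
    -- symmetry, so twice the value is zero.
    defect-column : ∀ x x′ y → defect x y x′ y ≈ 0#
    defect-column x x′ y = halve (begin
      defect x y x′ y + defect x y x′ y
        ≈⟨ +-congˡ (defect-sym x y x′ y) ⟩
      defect x y x′ y + defect x′ y x y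
        ≈⟨ outer-zero (defect-diagonal x y) (defect-diagonal x′ y) ⟨
      (defect x y x y + defect x y x′ y) + (defect x′ y x y + defect x′ y x′ y)
        ≈⟨ +-cong (expand x) (expand x′) ⟨
      defect x y (x ⊕ x′) y + defect x′ y (x ⊕ x′) y
        ≈⟨ defect-⊕ˡ x x′ y (x ⊕ x′) y ⟨
      defect (x ⊕ x′) y (x ⊕ x′) y
        ≈⟨ defect-diagonal (x ⊕ x′) y ⟩
      0# ∎)
      where
      expand : ∀ z → defect z y (x ⊕ x′) y ≈ defect z y x y + defect z y x′ y
      expand z = trans (defect-sym z y (x ⊕ x′) y) (trans (defect-⊕ˡ x x′ y z y)
        (+-cong (defect-sym x y z y) (defect-sym x′ y z y)))

    -- Polarization in y of `defect-column`, applied to y + y′.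
    defect-swap : ∀ x y x′ y′ → defect x y x′ y′ + defect x y′ x′ y ≈ 0#
    defect-swap x y x′ y′ = begin
      defect x y x′ y′ + defect x y′ x′ y
        ≈⟨ outer-zero (defect-column x x′ y) (defect-column x x′ y′) ⟨
      (defect x y x′ y + defect x y x′ y′) + (defect x y′ x′ y + defect x y′ x′ y′)
        ≈⟨ +-cong (expand y) (expand y′) ⟨
      defect x y x′ (y ⊕ y′) + defect x y′ x′ (y ⊕ y′)
        ≈⟨ defect-⊕ʳ x y y′ x′ (y ⊕ y′) ⟨
      defect x (y ⊕ y′) x′ (y ⊕ y′)
        ≈⟨ defect-column x x′ (y ⊕ y′) ⟩
      0# ∎
      where
      expand : ∀ z → defect x z x′ (y ⊕ y′) ≈ defect x z x′ y + defect x z x′ y′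
      expand z = trans (defect-sym x z x′ (y ⊕ y′)) (trans (defect-⊕ʳ x′ y y′ x z)
        (+-cong (defect-sym x′ y x z) (defect-sym x′ y′ x z)))

    -- For x′ = x the two terms of `defect-swap` coincide by symmetry.
    defect-row : ∀ x y y′ → defect x y x y′ ≈ 0#
    defect-row x y y′ = halve (trans (+-congˡ (defect-sym x y x y′)) (defect-swap x y x y′))

    -- A common zero of the uₜ is a zero of ∑ ℓₖ², hence of every ℓₖ, so both Gram forms vanish
    -- there.
    defect-zero : (∀ f → ∑[ k < r ] (f k * f k) ≈ 0# → ∀ k → f k ≈ 0#) →
                  ∀ x y → (∀ t → eval (u t) x y ≈ 0#) → ∀ x′ y′ → defect x y x′ y′ ≈ 0#
    defect-zero squares-zero x y u≈0 x′ y′ = equal⇒zero (trans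
      (gram-zero ℓ x y (squares-zero (λ k → eval (ℓ k) x y)
        (trans (same x y) (gram-zero u x y u≈0 x y))) x′ y′)
      (sym (gram-zero u x y u≈0 x′ y′)))

  module _ {m n r N : ℕ} {_≥0 : Carrier → Set} (cone : IsPositiveCone _≥0)
    (ℓ : Family r m n) (u : Family N m n) (row : Fin N → Fin m) (col : Fin N → Fin n)
    (u-triangular : ∀ t s → u t (row s) (col s) ≈ δ s t) where

    open IsPositiveCone cone

    -- At the selected cells the coefficients of u form the identity matrix, so their Gram matrix is
    -- the identity too. Equality carries this over to ℓ, whose coefficient columns there become
    -- orthonormal.
    gram-equal⇒≤ : (∀ i j k l → gram ℓ (δ i) (δ j) (δ k) (δ l) ≈ gram u (δ i) (δ j) (δ k) (δ l)) → N ≤ r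
    gram-equal⇒≤ gram-equal = orthonormal-≤ (λ k s → ℓ k (row s) (col s)) λ s t → begin
      ∑[ k < r ] (ℓ k (row s) (col s) * ℓ k (row t) (col t))
        ≈⟨ gram-δ ℓ (row s) (col s) (row t) (col t) ⟨
      gram ℓ (δ (row s)) (δ (col s)) (δ (row t)) (δ (col t))
        ≈⟨ gram-equal (row s) (col s) (row t) (col t) ⟩
      gram u (δ (row s)) (δ (col s)) (δ (row t)) (δ (col t))
        ≈⟨ gram-δ u (row s) (col s) (row t) (col t) ⟩
      ∑[ k < N ] (u k (row s) (col s) * u k (row t) (col t))
        ≈⟨ sum-cong-≋ (λ k → trans (*-cong (u-triangular k s)
             (trans (u-triangular k t) (reflexive (δ-sym t k)))) (*-comm (δ s k) (δ k t))) ⟩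
      ∑[ k < N ] (δ k t * δ s k)
        ≈⟨ sum-δ (λ k → δ k t) s ⟩
      δ s t ∎

  -- The eighth zero (e₁ + e₂, e₁ + e₃ + e₄).

  blockˡ : Vector Carrier 5
  blockˡ = δ 0F ⊕ δ 1F

  blockʳ : Vector Carrier 4
  blockʳ = δ 0F ⊕ (δ 2F ⊕ δ 3F)

  -- General in h because it serves twice: for the evaluation of uₜ and for H with its second pair
  -- of arguments fixed.
  block-expansion : (h : Vector Carrier 5 → Vector Carrier 4 → Carrier) →
    (∀ x x′ y → h (x ⊕ x′) y ≈ h x y + h x′ y) → (∀ x y y′ → h x (y ⊕ y′) ≈ h x y + h x y′) →
    h blockˡ blockʳ ≈ ∑[ s < 6 ] h (δ (rowOf s)) (δ (colOf s))
  block-expansion h h-⊕ˡ h-⊕ʳ = begin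
    h blockˡ blockʳ
      ≈⟨ h-⊕ˡ (δ 0F) (δ 1F) blockʳ ⟩
    h (δ 0F) blockʳ + h (δ 1F) blockʳ
      ≈⟨ +-cong (expand 0F) (expand 1F) ⟩
    (e 0F 0F + (e 0F 2F + e 0F 3F)) + (e 1F 0F + (e 1F 2F + e 1F 3F))
      -- The trailing `con 0` is the empty sum that ends the sum over `Fin 6`.
      ≈⟨ solve 6 (λ a b c d e f → (a :+ (b :+ c)) :+ (d :+ (e :+ f)) :=
                                  a :+ (b :+ (c :+ (d :+ (e :+ (f :+ con 0))))))
           refl (e 0F 0F) (e 0F 2F) (e 0F 3F) (e 1F 0F) (e 1F 2F) (e 1F 3F) ⟩
    ∑[ s < 6 ] h (δ (rowOf s)) (δ (colOf s)) ∎
    where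
    e : Fin 5 → Fin 4 → Carrier
    e i j = h (δ i) (δ j)

    expand : ∀ i → h (δ i) blockʳ ≈ e i 0F + (e i 2F + e i 3F)
    expand i = trans (h-⊕ʳ (δ i) (δ 0F) (δ 2F ⊕ δ 3F)) (+-congˡ (h-⊕ʳ (δ i) (δ 2F) (δ 3F)))

  -- Vanishing of H at all index tuples.

  module Rectangles (H : Fin 5 → Fin 4 → Fin 5 → Fin 4 → Carrier)
    (H-sym      : ∀ i j k l → H i j k l ≈ H k l i j)
    (H-swap     : ∀ i j k l → H i j k l + H i l k j ≈ 0#)
    (H-row      : ∀ i j l → H i j i l ≈ 0#)
    (H-column   : ∀ i j k → H i j k j ≈ 0#)
    (H-zeroCell : ∀ i j → (i , j) ∈ zeroCells → ∀ k l → H i j k l ≈ 0#)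
    (H-block    : ∀ k l → ∑[ s < 6 ] H (rowOf s) (colOf s) k l ≈ 0#) where

    -- Exchanging the two cells preserves H and exchanging their columns negates it, so vanishing
    -- spreads over the orbit.
    H-orbit : ∀ {P : Relation} → (∀ {i j k l} → P i j k l → H i j k l ≈ 0#) →
              ∀ {i j k l} → Orbit P i j k l → H i j k l ≈ 0#
    H-orbit {P} P⇒0 {i} {j} {k} {l} = λ where
        (inj₁ p)               → P⇒0 p
        (inj₂ (inj₁ p))        → trans (H-sym i j k l) (P⇒0 p)
        (inj₂ (inj₂ (inj₁ p))) → swapped (P⇒0 p)
        (inj₂ (inj₂ (inj₂ p))) → swapped (trans (H-sym i l k j) (P⇒0 p))
      where
      swapped : H i l k j ≈ 0# → H i j k l ≈ 0#
      swapped eq = trans (sym (trans (+-congˡ eq) (+-identityʳ (H i j k l)))) (H-swap i j k l)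

    H-obvious : ∀ {i j k l} → Obvious i j k l → H i j k l ≈ 0#
    H-obvious {i} {j} {k} {l} (inj₁ ≡.refl)        = H-row i j l
    H-obvious {i} {j} {k} {l} (inj₂ (inj₁ ≡.refl)) = H-column i j k
    H-obvious {i} {j} {k} {l} (inj₂ (inj₂ ij∈))    = H-zeroCell i j ij∈ k l

    H-isolated : ∀ {i j k l} → Isolated i j k l → H i j k l ≈ 0#
    H-isolated {k = k} {l} (t , ≡.refl , others) = trans
      (sym (sum-isolate (λ s → H (rowOf s) (colOf s) k l) t λ s → zero-or-t s (others s)))
      (H-block k l)
      where
      zero-or-t : ∀ s → s ≡ t ⊎ Orbit Obvious (rowOf s) (colOf s) k l →
                  s ≡ t ⊎ H (rowOf s) (colOf s) k l ≈ 0#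
      zero-or-t s (inj₁ s≡t) = inj₁ s≡t
      zero-or-t s (inj₂ o)   = inj₂ (H-orbit {Obvious} H-obvious o)

    H-step : ∀ {i j k l} → Orbit Obvious i j k l ⊎ Isolated i j k l → H i j k l ≈ 0#
    H-step (inj₁ o) = H-orbit {Obvious} H-obvious o
    H-step (inj₂ p) = H-isolated p

    H-zero : ∀ i j k l → H i j k l ≈ 0#
    H-zero i j k l = H-orbit {λ i j k l → Orbit Obvious i j k l ⊎ Isolated i j k l} H-step (exhausted i j k l)

  -- The lower bound on the number of squares.

  module _ {_≥0 : Carrier → Set} (cone : IsPositiveCone _≥0) (halve : ∀ {x} → x + x ≈ 0# → x ≈ 0#)
    {r N : ℕ} (ℓ : Family r 5 4) (u : Family N 5 4) (free : Fin N → Cell)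
    (u-free      : ∀ t s → u t (proj₁ (free s)) (proj₂ (free s)) ≈ δ s t)
    (u-zeroCells : ∀ t i j → (i , j) ∈ zeroCells → u t i j ≈ 0#)
    (u-block     : ∀ t → ∑[ s < 6 ] u t (rowOf s) (colOf s) ≈ 0#)
    (same        : ∀ x y → gram ℓ x y x y ≈ gram u x y x y) where

    open IsPositiveCone cone using (squares-zero)
    open Comparison halve ℓ u same

    eval-block : ∀ t → eval (u t) blockˡ blockʳ ≈ 0#
    eval-block t = begin
      eval (u t) blockˡ blockʳ                           ≈⟨ block-expansion (eval (u t)) (eval-⊕ˡ (u t)) (eval-⊕ʳ (u t)) ⟩
      ∑[ s < 6 ] eval (u t) (δ (rowOf s)) (δ (colOf s))  ≈⟨ sum-cong-≋ (λ s → eval-δ (u t) (rowOf s) (colOf s)) ⟩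
      ∑[ s < 6 ] u t (rowOf s) (colOf s)                 ≈⟨ u-block t ⟩
      0#                                                 ∎

    defect-block : ∀ k l → ∑[ s < 6 ] defect (δ (rowOf s)) (δ (colOf s)) (δ k) (δ l) ≈ 0#
    defect-block k l = trans
      (sym (block-expansion (λ x y → defect x y (δ k) (δ l))
        (λ x x′ y → defect-⊕ˡ x x′ y (δ k) (δ l)) (λ x y y′ → defect-⊕ʳ x y y′ (δ k) (δ l))))
      (defect-zero squares-zero blockˡ blockʳ eval-block (δ k) (δ l))

    open Rectangles (λ i j k l → defect (δ i) (δ j) (δ k) (δ l))
      (λ i j k l → defect-sym (δ i) (δ j) (δ k) (δ l))
      (λ i j k l → defect-swap (δ i) (δ j) (δ k) (δ l))
      (λ i j l → defect-row (δ i) (δ j) (δ l))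
      (λ i j k → defect-column (δ i) (δ k) (δ j))
      (λ i j ij∈ k l → defect-zero squares-zero (δ i) (δ j)
        (λ t → trans (eval-δ (u t) i j) (u-zeroCells t i j ij∈)) (δ k) (δ l))
      defect-block

    sos-length : N ≤ r
    sos-length = gram-equal⇒≤ cone ℓ u (proj₁ ∘ free) (proj₂ ∘ free) u-free
      λ i j k l → x∙y⁻¹≈ε⇒x≈y (gram ℓ (δ i) (δ j) (δ k) (δ l)) (gram u (δ i) (δ j) (δ k) (δ l)) (H-zero i j k l)

-- Positivity and halving in ℝ.

open BilinearForms using (IsPositiveCone; δ; δ-refl; δ-off; eval; gram; quartic; squares; quartic-squares; sos-length)
open Defs using (sum-syntax)

≗⇒≈ᴿ : ∀ x y → (∀ n → seq x n ≡ seq y n) → x ≈ᴿ y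
≗⇒≈ᴿ x y eq ε 0<ε = 0 , λ n _ → ≡.subst (ℚ._< ε)
  (≡.sym (≡.cong ℚ.∣_∣ (≡.trans (≡.cong (ℚ._- seq y n) (eq n)) (ℚ.+-inverseʳ (seq y n))))) 0<ε

-- A condition on the representing sequence, not invariant under `_≈ᴿ_`. Squares satisfy it
-- termwise, and sums preserve it.
NonNegative : ℝ → Set
NonNegative x = ∀ n → 0ℚ ℚ.≤ seq x n

abs-0≤ : ∀ {p} → 0ℚ ℚ.≤ p → ℚ.∣ p ℚ.- 0ℚ ∣ ≡ p
abs-0≤ {p} 0≤p = ≡.trans (≡.cong ℚ.∣_∣ (ℚ.+-identityʳ p)) (ℚ.0≤p⇒∣p∣≡p 0≤p)

0≤p*p : ∀ p → 0ℚ ℚ.≤ p ℚ.* p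
0≤p*p p with ℚ.≤-total 0ℚ p
... | inj₁ 0≤p = ℚ.nonNegative⁻¹ (p ℚ.* p) {{ℚ.nonNeg*nonNeg⇒nonNeg p p}}
  where instance _ = ℚ.nonNegative 0≤p
... | inj₂ p≤0 = ℚ.nonNegative⁻¹ (p ℚ.* p) {{ℚ.nonPos*nonPos⇒nonPos p p}}
  where instance _ = ℚ.nonPositive p≤0

-- By decidability of the order on ℚ: |p| ≥ ε would give |p²| ≥ ε². The differences with 0 match the
-- definition of `_≈ᴿ_`.
abs-square-< : ∀ p {ε} → 0ℚ ℚ.< ε → ℚ.∣ p ℚ.* p ℚ.- 0ℚ ∣ ℚ.< ε ℚ.* ε → ℚ.∣ p ℚ.- 0ℚ ∣ ℚ.< ε
abs-square-< p {ε} 0<ε p²<ε² with ℚ.∣ p ℚ.- 0ℚ ∣ ℚ.<? ε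
... | yes p<ε = p<ε
... | no  p≮ε = contradiction (ℚ.<-≤-trans p²<ε² ε²≤p²) (ℚ.<-irrefl ≡.refl)
  where
  open ℚ.≤-Reasoning
  q = ℚ.∣ p ∣
  instance
    _ = ℚ.nonNegative (ℚ.<⇒≤ 0<ε)
    _ = ℚ.∣-∣-nonNeg p
  ε≤q : ε ℚ.≤ q
  ε≤q = ≡.subst (ε ℚ.≤_) (≡.cong ℚ.∣_∣ (ℚ.+-identityʳ p)) (ℚ.≮⇒≥ p≮ε)
  ε²≤p² : ε ℚ.* ε ℚ.≤ ℚ.∣ p ℚ.* p ℚ.- 0ℚ ∣
  ε²≤p² = begin
    ε ℚ.* ε                 ≤⟨ ℚ.*-monoʳ-≤-nonNeg ε ε≤q ⟩
    q ℚ.* ε                 ≤⟨ ℚ.*-monoˡ-≤-nonNeg q ε≤q ⟩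
    q ℚ.* q                 ≡⟨ ℚ.∣p*q∣≡∣p∣*∣q∣ p p ⟨
    ℚ.∣ p ℚ.* p ∣           ≡⟨ ≡.cong ℚ.∣_∣ (ℚ.+-identityʳ (p ℚ.* p)) ⟨
    ℚ.∣ p ℚ.* p ℚ.- 0ℚ ∣    ∎

nonNegative-cone : IsPositiveCone ℝ-commutativeRing NonNegative
nonNegative-cone = record
  { 0≥0       = λ _ → ℚ.≤-refl
  ; 1≥0       = λ _ → ℚ.nonNegative⁻¹ 1ℚ
  ; +-≥0      = λ x≥0 y≥0 n → ℚ.+-mono-≤ (x≥0 n) (y≥0 n)
  ; square-≥0 = λ x n → 0≤p*p (seq x n)
  -- Termwise |x| = x ≤ x + y = |x + y|, so the modulus for x + y works for x.
  ; conical   = λ {x} {y} x≥0 y≥0 x+y≈0 ε 0<ε →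
      let N , close = x+y≈0 ε 0<ε
      in N , λ n N≤n → ℚ.≤-<-trans
           (begin
             ℚ.∣ seq x n ℚ.- 0ℚ ∣                  ≡⟨ abs-0≤ (x≥0 n) ⟩
             seq x n                               ≡⟨ ℚ.+-identityʳ (seq x n) ⟨
             seq x n ℚ.+ 0ℚ                        ≤⟨ ℚ.+-monoʳ-≤ (seq x n) (y≥0 n) ⟩
             seq x n ℚ.+ seq y n                   ≡⟨ abs-0≤ (ℚ.+-mono-≤ (x≥0 n) (y≥0 n)) ⟨
             ℚ.∣ (seq x n ℚ.+ seq y n) ℚ.- 0ℚ ∣    ∎)
           (close n N≤n)
  -- Precision ε² for x² gives precision ε for x.
  ; reduced   = λ x x²≈0 ε 0<ε →
      let instance posε = ℚ.positive 0<ε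
          N , close = x²≈0 (ε ℚ.* ε) (ℚ.positive⁻¹ (ε ℚ.* ε) {{ℚ.pos*pos⇒pos ε ε}})
      in N , λ n N≤n → abs-square-< (seq x n) 0<ε (close n N≤n)
  ; 1≉0       = λ 1≈0 →
      let N , close = 1≈0 1ℚ (ℚ.positive⁻¹ 1ℚ)
      in ℚ.<-irrefl ≡.refl (close N ℕ.≤-refl)
  }
  where open ℚ.≤-Reasoning

double≈0⇒≈0 : ∀ {x} → x +ᴿ x ≈ᴿ 0ᴿ → x ≈ᴿ 0ᴿ
double≈0⇒≈0 {x} 2x≈0 = begin
  x                          ≈⟨ ≗⇒≈ᴿ x (fromℚ ½ *ᴿ (x +ᴿ x)) (λ n → half (seq x n)) ⟩
  fromℚ ½ *ᴿ (x +ᴿ x)        ≈⟨ R.*-congˡ {fromℚ ½} {x +ᴿ x} {0ᴿ} 2x≈0 ⟩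
  fromℚ ½ *ᴿ 0ᴿ              ≈⟨ R.zeroʳ (fromℚ ½) ⟩
  0ᴿ                         ∎
  where
  module R = CommutativeRing ℝ-commutativeRing
  open SetoidReasoning R.setoid
  half : ∀ p → p ≡ ½ ℚ.* (p ℚ.+ p)
  half = solve 1 (λ p → p := con ½ :* (p :+ p)) ≡.refl
    where open ℚ-Solver.+-*-Solver

-- Passage between the abstract ring and the evaluations in ℝ.

-- Unfolding products in ℝ exposes their Cauchy moduli, and comparing those is infeasible.  The
-- ring's multiplication is therefore exchanged for _*ᴿ_ all at once, as a function argument,
-- and implicit arguments in ℝ are given explicitly.
mul≡*ᴿ : CommutativeRing._*_ ℝ-commutativeRing ≡ _*ᴿ_
mul≡*ᴿ = ≡.refl

module _ {m n : ℕ} where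

  quarticWith : (ℝ → ℝ → ℝ) → BiquadraticForm m n → (Fin m → ℝ) → (Fin n → ℝ) → ℝ
  quarticWith _∙_ a x y = ∑[ i < m ] ∑[ j < n ] ∑[ k < m ] ∑[ l < n ]
    ((((a i j k l ∙ x i) ∙ x k) ∙ y j) ∙ y l)

  quartic≡ : ∀ a x y → quartic ℝ-commutativeRing a x y ≡ evalBiquadratic a x y
  quartic≡ a x y = ≡.cong (λ _∙_ → quarticWith _∙_ a x y) {CommutativeRing._*_ ℝ-commutativeRing} {_*ᴿ_} mul≡*ᴿ

  evalWith : (ℝ → ℝ → ℝ) → BilinearForm m n → (Fin m → ℝ) → (Fin n → ℝ) → ℝ
  evalWith _∙_ a x y = ∑[ i < m ] ∑[ j < n ] ((a i j ∙ x i) ∙ y j)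

  eval≡ : eval ℝ-commutativeRing {m} {n} ≡ evalBilinear
  eval≡ = ≡.cong evalWith {CommutativeRing._*_ ℝ-commutativeRing} {_*ᴿ_} mul≡*ᴿ

  module _ {r : ℕ} (u : Fin r → BilinearForm m n) (x : Fin m → ℝ) (y : Fin n → ℝ) where

    gramWith : (BilinearForm m n → (Fin m → ℝ) → (Fin n → ℝ) → ℝ) → (ℝ → ℝ → ℝ) → ℝ
    gramWith ev _∙_ = ∑[ t < r ] (ev (u t) x y ∙ ev (u t) x y)

    gram≡ : gram ℝ-commutativeRing u x y x y ≡ ∑[ t < r ] (evalBilinear (u t) x y *ᴿ evalBilinear (u t) x y)
    gram≡ = ≡.cong₂ gramWith {eval ℝ-commutativeRing} {evalBilinear}
      {CommutativeRing._*_ ℝ-commutativeRing} {_*ᴿ_} eval≡ mul≡*ᴿ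

≈ᴿ-resp : ∀ (a a′ b b′ : ℝ) → a ≡ a′ → b ≡ b′ → a ≈ᴿ b → a′ ≈ᴿ b′
≈ᴿ-resp a a′ b b′ ≡.refl ≡.refl a≈b = a≈b

squares-isSumOfSquares : ∀ {m n r} (u : Fin r → BilinearForm m n) →
                         IsSumOfSquares (squares ℝ-commutativeRing u) r
squares-isSumOfSquares {r = r} u = u , λ x y →
  ≈ᴿ-resp (quartic ℝ-commutativeRing (squares ℝ-commutativeRing u) x y)
          (evalBiquadratic (squares ℝ-commutativeRing u) x y)
          (gram ℝ-commutativeRing u x y x y)
          (∑[ k < r ] (evalBilinear (u k) x y *ᴿ evalBilinear (u k) x y))
    (quartic≡ (squares ℝ-commutativeRing u) x y) (gram≡ u x y)
    (quartic-squares ℝ-commutativeRing u x y)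

equal-squares⇒equal-gram : ∀ {m n r s} (u : Fin r → BilinearForm m n) (ℓ : Fin s → BilinearForm m n) x y →
  evalBiquadratic (squares ℝ-commutativeRing u) x y ≈ᴿ
    (∑[ k < s ] (evalBilinear (ℓ k) x y *ᴿ evalBilinear (ℓ k) x y)) →
  gram ℝ-commutativeRing ℓ x y x y ≈ᴿ gram ℝ-commutativeRing u x y x y
equal-squares⇒equal-gram {s = s} u ℓ x y eq = R.trans
  {gram ℝ-commutativeRing ℓ x y x y} {P} {gram ℝ-commutativeRing u x y x y}
  (R.sym {P} {gram ℝ-commutativeRing ℓ x y x y}
    (≈ᴿ-resp (evalBiquadratic (squares ℝ-commutativeRing u) x y) P
             (∑[ k < s ] (evalBilinear (ℓ k) x y *ᴿ evalBilinear (ℓ k) x y))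
             (gram ℝ-commutativeRing ℓ x y x y)
      (≡.sym (quartic≡ (squares ℝ-commutativeRing u) x y)) (≡.sym (gram≡ ℓ x y)) eq))
  (quartic-squares ℝ-commutativeRing u x y)
  where
  module R = CommutativeRing ℝ-commutativeRing
  P = quartic ℝ-commutativeRing (squares ℝ-commutativeRing u) x y

-- Forms with rational coefficients.

seq-sum : ∀ {n} (f : Fin n → ℚ) k →
          seq (SemiringSum.sum (CommutativeRing.semiring ℝ-commutativeRing) (λ i → fromℚ (f i))) k ≡ foldr ℚ._+_ 0ℚ f
seq-sum {zero}  f k = ≡.refl
seq-sum {suc n} f k = ≡.cong (f zero ℚ.+_) (seq-sum (f ∘ suc) k)

-- Allows the block condition to be checked over ℚ, where equality is decidable.
fromℚ-sum≈0 : ∀ {n} (f : Fin n → ℚ) → foldr ℚ._+_ 0ℚ f ≡ 0ℚ →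
              SemiringSum.sum (CommutativeRing.semiring ℝ-commutativeRing) (λ i → fromℚ (f i)) ≈ᴿ 0ᴿ
fromℚ-sum≈0 f sum≡0 = ≗⇒≈ᴿ (SemiringSum.sum (CommutativeRing.semiring ℝ-commutativeRing) (λ i → fromℚ (f i))) 0ᴿ
  λ k → ≡.trans (seq-sum f k) sum≡0

module _ {N : ℕ} (c : Fin N → Fin 5 → Fin 4 → ℚ) (free : Fin N → Cell)
  (c-diagonal  : ∀ t → c t (proj₁ (free t)) (proj₂ (free t)) ≡ 1ℚ)
  (c-off       : ∀ t s → t ≡ s ⊎ c t (proj₁ (free s)) (proj₂ (free s)) ≡ 0ℚ)
  (c-zeroCells : ∀ t i j → (i , j) ∈ zeroCells → c t i j ≡ 0ℚ)
  (c-block     : ∀ t → foldr ℚ._+_ 0ℚ (λ s → c t (rowOf s) (colOf s)) ≡ 0ℚ) where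

  rationalForms-free : ∀ t s → fromℚ (c t (proj₁ (free s)) (proj₂ (free s))) ≡ δ ℝ-commutativeRing s t
  rationalForms-free t s with c-off t s | δ-off ℝ-commutativeRing s t
  ... | inj₁ ≡.refl | _           = ≡.trans (≡.cong fromℚ (c-diagonal t)) (≡.sym (δ-refl ℝ-commutativeRing t))
  ... | inj₂ _      | inj₁ ≡.refl = ≡.trans (≡.cong fromℚ (c-diagonal t)) (≡.sym (δ-refl ℝ-commutativeRing t))
  ... | inj₂ c≡0    | inj₂ δ≡0    = ≡.trans (≡.cong fromℚ c≡0) (≡.sym δ≡0)

  -- The forms themselves give the decomposition; minimality is `sos-length` against an arbitrary
  -- competing one.
  rationalForms-sosRank : IsSosRank (squares ℝ-commutativeRing (λ t i j → fromℚ (c t i j))) N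
  rationalForms-sosRank = squares-isSumOfSquares (λ t i j → fromℚ (c t i j)) , λ s (ℓ , eq) →
    sos-length ℝ-commutativeRing nonNegative-cone (λ {x} → double≈0⇒≈0 {x}) ℓ (λ t i j → fromℚ (c t i j)) free
      (λ t s → CommutativeRing.reflexive ℝ-commutativeRing (rationalForms-free t s))
      (λ t i j ij∈ → CommutativeRing.reflexive ℝ-commutativeRing (≡.cong fromℚ (c-zeroCells t i j ij∈)))
      (λ t → fromℚ-sum≈0 (λ s → c t (rowOf s) (colOf s)) (c-block t))
      (λ x y → equal-squares⇒equal-gram (λ t i j → fromℚ (c t i j)) ℓ x y (eq x y))

-- The twelve forms uₜ.

-- The t-th cell leads uₜ; the block cell (0,0) is the one eliminated.
free : Fin 12 → Cell
free = lookup
  ( (0F , 2F) ∷ (1F , 0F) ∷ (1F , 3F)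
  ∷ (0F , 1F) ∷ (1F , 1F) ∷ (2F , 0F) ∷ (2F , 2F) ∷ (2F , 3F)
  ∷ (3F , 1F) ∷ (3F , 2F) ∷ (4F , 1F) ∷ (4F , 3F) ∷ [])

-- The entry -1 at (0,0) balances a leading cell inside the block, so that uₜ vanishes at the eighth
-- zero; this happens for (0,2), (1,0) and (1,3). The count is 12 = 20 - 7 - 1.
coefficient : Fin 12 → Fin 5 → Fin 4 → ℚ
coefficient t i j =
  if does ((i , j) ≟ᶜ free t) then 1ℚ
  else if does ((i , j) ≟ᶜ (0F , 0F)) ∧ does (any? λ s → block s ≟ᶜ free t) then ℚ.- 1ℚ
  else 0ℚ

coefficient-diagonal : ∀ t → coefficient t (proj₁ (free t)) (proj₂ (free t)) ≡ 1ℚ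
coefficient-diagonal = from-yes (all? λ t → coefficient t (proj₁ (free t)) (proj₂ (free t)) ℚ.≟ 1ℚ)

coefficient-off : ∀ t s → t ≡ s ⊎ coefficient t (proj₁ (free s)) (proj₂ (free s)) ≡ 0ℚ
coefficient-off = from-yes (all? λ t → all? λ s →
  t ≟ s ⊎-dec coefficient t (proj₁ (free s)) (proj₂ (free s)) ℚ.≟ 0ℚ)

coefficient-zeroCells : ∀ t i j → (i , j) ∈ zeroCells → coefficient t i j ≡ 0ℚ
coefficient-zeroCells = from-yes (all? λ t → all? λ i → all? λ j →
  (i , j) ∈? zeroCells →-dec coefficient t i j ℚ.≟ 0ℚ)

coefficient-block : ∀ t → foldr ℚ._+_ 0ℚ (λ s → coefficient t (rowOf s) (colOf s)) ≡ 0ℚ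
coefficient-block = from-yes (all? λ t → foldr ℚ._+_ 0ℚ (λ s → coefficient t (rowOf s) (colOf s)) ℚ.≟ 0ℚ)

sosRank-12 : SosRankAttained 5 4 12
sosRank-12 = squares ℝ-commutativeRing (λ t i j → fromℚ (coefficient t i j)) ,
  rationalForms-sosRank coefficient free
    coefficient-diagonal coefficient-off coefficient-zeroCells coefficient-block

-- `IsBSR` is a relation that does not assert existence of a value; the first component therefore
-- exhibits an attained rank outright.
mainTheorem2 : (∃[ r ] (SosRankAttained 5 4 r × 12 ≤ r)) × (∀ b → IsBSR 5 4 b → 12 ≤ b)
mainTheorem2 = (12 , sosRank-12 , ℕ.≤-refl) , λ b (_ , maximal) → maximal 12 sosRank-12
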